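{- Let $n\ge 2$, let $w\in\widetilde{C}_n$, and let $i,j\in\mathbb{Z}\setminus (n+1)\mathbb{Z}$ with $i\not\equiv j \pmod{2n+2}$. Then $$w\, t^c_{i,j} = t^c_{w(i),w(j)}\, w .$$
   Context: $\widetilde{C}_n$ is the affine Weyl group of type C, with generators $s_0,s_1,\dots,s_n$ and relations $s_i^2=1$; $s_is_j=s_js_i$ if $|i-j|>1$; $s_is_{i+1}s_i=s_{i+1}s_is_{i+1}$ for $1\le i\le n-2$; $s_0s_1s_0s_1=s_1s_0s_1s_0$; $s_{n-1}s_ns_{n-1}s_n=s_ns_{n-1}s_ns_{n-1}$. It is realized (faithfully) as a group of permutations of $\mathbb{Z}$, with product being composition, as follows (all congruences modulo $2n+2$): - for $0<i<n$: $s_i(x)=x+1$ if $x\equiv i$ or $x\equiv -i-1$; $s_i(x)=x-1$ if $x\equiv i+1$ or $x\equiv -i$; $s_i(x)=x$ otherwise; - $s_0(x)=x+2$ if $x\equiv -1$; $s_0(x)=x-2$ if $x\equiv 1$; $s_0(x)=x$ otherwise; - $s_n(x)=x+2$ if $x\equiv n$; $s_n(x)=x-2$ if $x\equiv n+2$; $s_n(x)=x$ otherwise. Every $w\in\widetilde{C}_n$ satisfies $w(x)+w(2a(n+1)-x)=2a(n+1)$ for all $a,x\in\mathbb{Z}$; in particular $w(-x)=-w(x)$ and $w(a(n+1))=a(n+1)$. Type C transposition: for $i,j\in\mathbb{Z}\setminus(n+1)\mathbb{Z}$ with $i\not\equiv j\pmod{2n+2}$, $t^c_{i,j}$ is the unique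 element of $\widetilde{C}_n$ such that for all $q\in\mathbb{Z}$ $$t^c_{i,j}(i+q(2n+2))=j+q(2n+2),\quad t^c_{i,j}(j+q(2n+2))=i+q(2n+2),$$ $$t^c_{i,j}(-i+q(2n+2))=-j+q(2n+2),\quad t^c_{i,j}(-j+q(2n+2))=-i+q(2n+2),$$ and $t^c_{i,j}(x)=x$ for all other $x\in\mathbb{Z}$. -}

module Defs where

open import Algebra.Bundles using (Group)
open import Data.Bool.Base using (if_then_else_)
open import Data.Empty using (⊥-elim)
open import Data.Integer.Base using (ℤ; +_; -[1+_]; -_; _+_; _-_; _*_; 0ℤ; 1ℤ)
open import Data.Integer.Divisibility.Signed
open import Data.Integer.DivMod using (_%ℕ_; _/ℕ_; a≡a%ℕn+[a/ℕn]*n; n%ℕd<d)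
import Data.Integer.Properties as ℤ
open import Data.Integer.Tactic.RingSolver using (solve-∀)
open import Data.Nat.Base as ℕ using (ℕ; zero; suc; z≤n; s≤s)
open import Data.Nat.Divisibility using (>⇒∤)
import Data.Nat.Properties as ℕ
open import Data.Product.Base using (Σ-syntax; _,_; proj₁; proj₂)
open import Data.Sum.Base using (_⊎_; inj₁; inj₂; [_,_]′)
open import Function.Base using (_∘_)
open import Function.Bundles using (_↔_; Inverse; mk↔ₛ′)
open import Function.Construct.Composition using (_↔-∘_)
open import Function.Construct.Identity using (↔-id)
open import Function.Construct.Symmetry using (↔-sym)
open import Level using (0ℓ)
open import Relation.Binary.Construct.Closure.ReflexiveTransitive using (Star; ε; _◅_)
open import Relation.Binary.Definitions using (tri<; tri≈; tri>)
open import Relation.Binary.PropositionalEquality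
  using (_≡_; refl; sym; trans; cong; subst; subst₂; module ≡-Reasoning)
open import Relation.Nullary.Decidable using (Dec; yes; no; does; dec-true; dec-false; _⊎-dec_)
open import Relation.Nullary.Negation using (¬_)

module TypeC (n : ℕ) (2≤n : 2 ℕ.≤ n) where

  N : ℤ
  N = + (2 ℕ.* n ℕ.+ 2)

  infix 4 _≅_ _≅?_

  _≅_ : ℤ → ℤ → Set
  x ≅ y = N ∣ x - y

  _≅?_ : ∀ x y → Dec (x ≅ y)
  x ≅? y = N ∣? x - y

  Wall : ℤ → Set
  Wall x = + (n ℕ.+ 1) ∣ x

  data Gen : Set where
    s₀ : Gen
    s  : (i : ℕ) → 0 ℕ.< i → i ℕ.< n → Gen
    sₙ : Gen

  act : Gen → ℤ → ℤ
  act s₀ x =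
    if does (x ≅? - + 1) then x + + 2 else
    if does (x ≅? + 1)   then x - + 2 else x
  act (s i _ _) x =
    if does (x ≅? + i ⊎-dec x ≅? - + i - + 1)     then x + + 1 else
    if does (x ≅? + i + + 1 ⊎-dec x ≅? - + i) then x - + 1 else x
  act sₙ x =
    if does (x ≅? + n)       then x + + 2 else
    if does (x ≅? + n + + 2) then x - + 2 else x

  private
    by : ∀ {u v} → v ≡ u → N ∣ u → N ∣ v
    by eq = subst (N ∣_) (sym eq)

    by- : ∀ {u v} → v ≡ - u → N ∣ u → N ∣ v
    by- eq p = by eq (∣m⇒∣-m p)

    by₂ : ∀ {u u′ v} → v ≡ u + u′ → N ∣ u → N ∣ u′ → N ∣ v
    by₂ eq p q = by eq (∣m∣n⇒∣m+n p q)

    by₂- : ∀ {u u′ v} → v ≡ u - u′ → N ∣ u → N ∣ u′ → N ∣ v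
    by₂- eq p q = by eq (∣m∣n⇒∣m-n p q)

    N∣kN : ∀ k → N ∣ k * N
    N∣kN k = divides k refl

    ≅-refl : ∀ {x} → x ≅ x
    ≅-refl {x} = divides 0ℤ (e x)
      where
      e : ∀ x → x - x ≡ 0ℤ
      e = solve-∀

    ≅-sym : ∀ {x y} → x ≅ y → y ≅ x
    ≅-sym {x} {y} = by- (e x y)
      where
      e : ∀ x y → y - x ≡ - (x - y)
      e = solve-∀

    ≅-trans : ∀ {x y z} → x ≅ y → y ≅ z → x ≅ z
    ≅-trans {x} {y} {z} = by₂ (e x y z)
      where
      e : ∀ x y z → x - z ≡ (x - y) + (y - z)
      e = solve-∀

    ≅-neg : ∀ {x y} → x ≅ y → - x ≅ - y
    ≅-neg {x} {y} = by- (e x y)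
      where
      e : ∀ x y → - x - - y ≡ - (x - y)
      e = solve-∀

    ≅-neg⁻¹ : ∀ {x y} → x ≅ - y → - x ≅ y
    ≅-neg⁻¹ {x} {y} = by- (e x y)
      where
      e : ∀ x y → - x - y ≡ - (x - - y)
      e = solve-∀

    shift-≅ : ∀ x k → x + k * N ≅ x
    shift-≅ x k = by (e x (k * N)) (N∣kN k)
      where
      e : ∀ x k → x + k - x ≡ k
      e = solve-∀

    ≅⇒shift : ∀ {x y} → x ≅ y → Σ[ k ∈ ℤ ] x ≡ y + k * N
    ≅⇒shift {x} {y} (divides k eq) = k , trans (e x y) (cong (λ z → y + z) eq)
      where
      e : ∀ x y → x ≡ y + (x - y)
      e = solve-∀

    N≡ : N ≡ + 2 * + n + + 2
    N≡ = cong (_+ + 2) (ℤ.pos-* 2 n)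

    small : ∀ k → 0 ℕ.< k → k ℕ.< 2 ℕ.* n ℕ.+ 2 → ¬ N ∣ + k
    small k 0<k k<N p = >⇒∤ {{ℕ.>-nonZero 0<k}} k<N (∣⇒∣ᵤ p)

    2<N : 2 ℕ.< 2 ℕ.* n ℕ.+ 2
    2<N = ℕ.+-monoˡ-< 2 (ℕ.<-≤-trans (s≤s z≤n) (ℕ.*-monoʳ-≤ 2 2≤n))

    N∤1 : ¬ N ∣ + 1
    N∤1 = small 1 (s≤s z≤n) (ℕ.<-trans (s≤s (s≤s z≤n)) 2<N)

    N∤2 : ¬ N ∣ + 2
    N∤2 = small 2 (s≤s z≤n) 2<N

    -- Behaviour common to all simple reflections: those with index 0, 0<i<n
    -- and n have (a , δ) = (-1 , 2), (i , 1) and (n , 2) respectively.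
    record Hop (a δ : ℤ) (f : ℤ → ℤ) : Set where
      field
        up₁   : ∀ {x} → x ≅ a       → f x ≡ x + δ
        up₂   : ∀ {x} → x ≅ - a - δ → f x ≡ x + δ
        down₁ : ∀ {x} → x ≅ a + δ   → f x ≡ x - δ
        down₂ : ∀ {x} → x ≅ - a     → f x ≡ x - δ
        stay  : ∀ {x} → ¬ x ≅ a → ¬ x ≅ - a - δ → ¬ x ≅ a + δ → ¬ x ≅ - a → f x ≡ x

    base : Gen → ℤ
    base s₀        = - + 1
    base (s i _ _) = + i
    base sₙ        = + n

    width : Gen → ℤ
    width s₀        = + 2
    width (s _ _ _) = + 1
    width sₙ        = + 2

    module _ {P Q : Set} (P? : Dec P) (Q? : Dec Q) {a b c : ℤ} where
      first : P → (if does P? then a else if does Q? then b else c) ≡ a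
      first p rewrite dec-true P? p = refl

      second : ¬ P → Q → (if does P? then a else if does Q? then b else c) ≡ b
      second ¬p q rewrite dec-false P? ¬p | dec-true Q? q = refl

      third : ¬ P → ¬ Q → (if does P? then a else if does Q? then b else c) ≡ c
      third ¬p ¬q rewrite dec-false P? ¬p | dec-false Q? ¬q = refl

    hop : ∀ g → Hop (base g) (width g) (act g)
    hop s₀ = record
      { up₁   = λ {x} p → first (x ≅? - + 1) (x ≅? + 1) p
      ; up₂   = λ {x} p → first (x ≅? - + 1) (x ≅? + 1) p
      ; down₁ = λ {x} p → second (x ≅? - + 1) (x ≅? + 1) (apart {x} p) p
      ; down₂ = λ {x} p → second (x ≅? - + 1) (x ≅? + 1) (apart {x} p) p
      ; stay  = λ {x} p _ q _ → third (x ≅? - + 1) (x ≅? + 1) p q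
      }
      where
      e : ∀ x → + 2 ≡ (x - - + 1) - (x - + 1)
      e = solve-∀
      apart : ∀ {x} → x ≅ + 1 → ¬ x ≅ - + 1
      apart {x} p q = N∤2 (by₂- (e x) q p)
    hop (s i 0<i i<n) = record
      { up₁   = λ {x} p → first (U x) (D x) (inj₁ p)
      ; up₂   = λ {x} p → first (U x) (D x) (inj₂ p)
      ; down₁ = λ {x} p → second (U x) (D x) (apart {x} (inj₁ p)) (inj₁ p)
      ; down₂ = λ {x} p → second (U x) (D x) (apart {x} (inj₂ p)) (inj₂ p)
      ; stay  = λ {x} p q r t → third (U x) (D x) [ p , q ]′ [ r , t ]′
      }
      where
      U = λ x → x ≅? + i ⊎-dec x ≅? - + i - + 1
      D = λ x → x ≅? + i + + 1 ⊎-dec x ≅? - + i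
      e₁ : ∀ x i → + 1 ≡ (x - i) - (x - (i + + 1))
      e₁ = solve-∀
      e₂ : ∀ x i → (i + + 1) + (i + + 1) ≡ (x - (- i - + 1)) - (x - (i + + 1))
      e₂ = solve-∀
      e₃ : ∀ x i → i + i ≡ (x - - i) - (x - i)
      e₃ = solve-∀
      e₄ : ∀ x i → + 1 ≡ (x - (- i - + 1)) - (x - - i)
      e₄ = solve-∀
      2n : n ℕ.+ n ≡ 2 ℕ.* n
      2n = cong (n ℕ.+_) (sym (ℕ.+-identityʳ n))
      i+i<2n : i ℕ.+ i ℕ.< 2 ℕ.* n
      i+i<2n = subst (i ℕ.+ i ℕ.<_) 2n (ℕ.+-mono-< i<n i<n)
      0<i+1 : 0 ℕ.< i ℕ.+ 1
      0<i+1 = ℕ.<-≤-trans 0<i (ℕ.m≤m+n i 1)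
      small₂ : (i ℕ.+ 1) ℕ.+ (i ℕ.+ 1) ℕ.< 2 ℕ.* n ℕ.+ 2
      small₂ = subst (ℕ._< 2 ℕ.* n ℕ.+ 2) (sym (e i)) (ℕ.+-monoˡ-< 2 i+i<2n)
        where
        open import Data.Nat.Tactic.RingSolver renaming (solve-∀ to ℕ-solve-∀)
        e : ∀ i → (i ℕ.+ 1) ℕ.+ (i ℕ.+ 1) ≡ (i ℕ.+ i) ℕ.+ 2
        e = ℕ-solve-∀
      apart : ∀ {x} → x ≅ + i + + 1 ⊎ x ≅ - + i → ¬ (x ≅ + i ⊎ x ≅ - + i - + 1)
      apart {x} (inj₁ p) (inj₁ q) = N∤1 (by₂- (e₁ x (+ i)) q p)
      apart {x} (inj₁ p) (inj₂ q) =
        small _ (ℕ.<-≤-trans 0<i+1 (ℕ.m≤m+n _ _)) small₂ (by₂- (e₂ x (+ i)) q p)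
      apart {x} (inj₂ p) (inj₁ q) =
        small _ (ℕ.<-≤-trans 0<i (ℕ.m≤m+n _ _)) (ℕ.<-≤-trans i+i<2n (ℕ.m≤m+n _ 2)) (by₂- (e₃ x (+ i)) p q)
      apart {x} (inj₂ p) (inj₂ q) = N∤1 (by₂- (e₄ x (+ i)) q p)
    hop sₙ = record
      { up₁   = λ {x} p → first (U x) (D x) p
      ; up₂   = λ {x} p → first (U x) (D x) (≅-trans {x} p e₁)
      ; down₁ = λ {x} p → second (U x) (D x) (apart {x} p) p
      ; down₂ = λ {x} p → second (U x) (D x) (apart {x} (≅-trans {x} p e₂)) (≅-trans {x} p e₂)
      ; stay  = λ {x} p _ q _ → third (U x) (D x) p q
      }
      where
      U = λ x → x ≅? + n
      D = λ x → x ≅? + n + + 2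
      e₁′ : ∀ n → (- n - + 2) - n ≡ - 1ℤ * (+ 2 * n + + 2)
      e₁′ = solve-∀
      e₁ : - + n - + 2 ≅ + n
      e₁ = divides (- 1ℤ) (trans (e₁′ (+ n)) (cong (- 1ℤ *_) (sym N≡)))
      e₂′ : ∀ n → - n - (n + + 2) ≡ - 1ℤ * (+ 2 * n + + 2)
      e₂′ = solve-∀
      e₂ : - + n ≅ + n + + 2
      e₂ = divides (- 1ℤ) (trans (e₂′ (+ n)) (cong (- 1ℤ *_) (sym N≡)))
      e : ∀ x n → + 2 ≡ (x - n) - (x - (n + + 2))
      e = solve-∀
      apart : ∀ {x} → x ≅ + n + + 2 → ¬ x ≅ + n
      apart {x} p q = N∤2 (by₂- (e x (+ n)) q p)

    module HopProperties {a δ f} (h : Hop a δ f) where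
      open Hop h

      data Position (x : ℤ) : Set where
        at-up₁   : x ≅ a → Position x
        at-up₂   : x ≅ - a - δ → Position x
        at-down₁ : x ≅ a + δ → Position x
        at-down₂ : x ≅ - a → Position x
        at-rest  : ¬ x ≅ a → ¬ x ≅ - a - δ → ¬ x ≅ a + δ → ¬ x ≅ - a → Position x

      position : ∀ x → Position x
      position x with x ≅? a | x ≅? - a - δ | x ≅? a + δ | x ≅? - a
      ... | yes p | _     | _     | _     = at-up₁ p
      ... | no p  | yes q | _     | _     = at-up₂ q
      ... | no p  | no q  | yes r | _     = at-down₁ r
      ... | no p  | no q  | no r  | yes t = at-down₂ t
      ... | no p  | no q  | no r  | no t  = at-rest p q r t

      x+δ-δ : ∀ x δ → x + δ - δ ≡ x
      x+δ-δ = solve-∀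

      x-δ+δ : ∀ x δ → x - δ + δ ≡ x
      x-δ+δ = solve-∀

      involutive : ∀ x → f (f x) ≡ x
      involutive x with position x
      ... | at-up₁ p rewrite up₁ {x} p = trans (down₁ (by (e x a δ) p)) (x+δ-δ x δ)
        where
        e : ∀ x a δ → x + δ - (a + δ) ≡ x - a
        e = solve-∀
      ... | at-up₂ p rewrite up₂ {x} p = trans (down₂ (by (e x a δ) p)) (x+δ-δ x δ)
        where
        e : ∀ x a δ → x + δ - - a ≡ x - (- a - δ)
        e = solve-∀
      ... | at-down₁ p rewrite down₁ {x} p = trans (up₁ (by (e x a δ) p)) (x-δ+δ x δ)
        where
        e : ∀ x a δ → x - δ - a ≡ x - (a + δ)
        e = solve-∀
      ... | at-down₂ p rewrite down₂ {x} p = trans (up₂ (by (e x a δ) p)) (x-δ+δ x δ)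
        where
        e : ∀ x a δ → x - δ - (- a - δ) ≡ x - - a
        e = solve-∀
      ... | at-rest p q r t = trans (cong f (stay {x} p q r t)) (stay {x} p q r t)

      mirror : ∀ k x → f (k * N - x) ≡ k * N - f x
      mirror k x with position x
      ... | at-up₁ p rewrite up₁ {x} p = trans (down₂ (by₂- (e x a K) (N∣kN k) p)) (e′ x δ K)
        where
        K = k * N
        e : ∀ x a K → K - x - - a ≡ K - (x - a)
        e = solve-∀
        e′ : ∀ x δ K → K - x - δ ≡ K - (x + δ)
        e′ = solve-∀
      ... | at-up₂ p rewrite up₂ {x} p = trans (down₁ (by₂- (e x a δ K) (N∣kN k) p)) (e′ x δ K)
        where
        K = k * N
        e : ∀ x a δ K → K - x - (a + δ) ≡ K - (x - (- a - δ))
        e = solve-∀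
        e′ : ∀ x δ K → K - x - δ ≡ K - (x + δ)
        e′ = solve-∀
      ... | at-down₁ p rewrite down₁ {x} p = trans (up₂ (by₂- (e x a δ K) (N∣kN k) p)) (e′ x δ K)
        where
        K = k * N
        e : ∀ x a δ K → K - x - (- a - δ) ≡ K - (x - (a + δ))
        e = solve-∀
        e′ : ∀ x δ K → K - x + δ ≡ K - (x - δ)
        e′ = solve-∀
      ... | at-down₂ p rewrite down₂ {x} p = trans (up₁ (by₂- (e x a K) (N∣kN k) p)) (e′ x δ K)
        where
        K = k * N
        e : ∀ x a K → K - x - a ≡ K - (x - - a)
        e = solve-∀
        e′ : ∀ x δ K → K - x + δ ≡ K - (x - δ)
        e′ = solve-∀
      ... | at-rest p q r t = trans
            (stay (λ p′ → t (by₂- (e₁ x a K) (N∣kN k) p′))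
                  (λ p′ → r (by₂- (e₂ x a δ K) (N∣kN k) p′))
                  (λ p′ → q (by₂- (e₃ x a δ K) (N∣kN k) p′))
                  (λ p′ → p (by₂- (e₄ x a K) (N∣kN k) p′)))
            (cong (_-_ K) (sym (stay {x} p q r t)))
        where
        K = k * N
        e₁ : ∀ x a K → x - - a ≡ K - (K - x - a)
        e₁ = solve-∀
        e₂ : ∀ x a δ K → x - (a + δ) ≡ K - (K - x - (- a - δ))
        e₂ = solve-∀
        e₃ : ∀ x a δ K → x - (- a - δ) ≡ K - (K - x - (a + δ))
        e₃ = solve-∀
        e₄ : ∀ x a K → x - a ≡ K - (K - x - - a)
        e₄ = solve-∀

  simple : Gen → ℤ ↔ ℤ
  simple g = mk↔ₛ′ (act g) (act g) involutive involutive
    where open HopProperties (hop g)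

  -- The constructor resp closes the subgroup under pointwise equality of
  -- permutations, which is the equality of the group C̃ below.
  data Generated : ℤ ↔ ℤ → Set where
    gen  : ∀ g → Generated (simple g)
    unit : Generated (↔-id ℤ)
    comp : ∀ {π ρ} → Generated π → Generated ρ → Generated (π ↔-∘ ρ)
    inv  : ∀ {π} → Generated π → Generated (↔-sym π)
    resp : ∀ {π ρ} → (∀ x → Inverse.to π x ≡ Inverse.to ρ x) → Generated π → Generated ρ

  record Element : Set where
    constructor element
    field
      perm      : ℤ ↔ ℤ
      generated : Generated perm

  open Element public

  infixr 7 _⟨$⟩_

  _⟨$⟩_ : Element → ℤ → ℤ
  w ⟨$⟩ x = Inverse.to (perm w) x

  private
    to-from : ∀ (π : ℤ ↔ ℤ) x → Inverse.to π (Inverse.from π x) ≡ x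
    to-from π x = Inverse.inverseˡ π refl

    from-to : ∀ (π : ℤ ↔ ℤ) x → Inverse.from π (Inverse.to π x) ≡ x
    from-to π x = Inverse.inverseʳ π refl

    from-cong : ∀ (π ρ : ℤ ↔ ℤ) → (∀ x → Inverse.to π x ≡ Inverse.to ρ x) →
                ∀ x → Inverse.from π x ≡ Inverse.from ρ x
    from-cong π ρ eq x =
      trans (cong (Inverse.from π) (trans (sym (to-from ρ x)) (sym (eq (Inverse.from ρ x)))))
            (from-to π (Inverse.from ρ x))

  C̃ : Group 0ℓ 0ℓ
  C̃ = record
    { Carrier = Element
    ; _≈_     = λ v w → ∀ x → v ⟨$⟩ x ≡ w ⟨$⟩ x
    ; _∙_     = λ v w → element (perm v ↔-∘ perm w) (comp (generated v) (generated w))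
    ; ε       = element (↔-id ℤ) unit
    ; _⁻¹     = λ w → element (↔-sym (perm w)) (inv (generated w))
    ; isGroup = record
      { isMonoid = record
        { isSemigroup = record
          { isMagma = record
            { isEquivalence = record
              { refl  = λ _ → refl
              ; sym   = λ p x → sym (p x)
              ; trans = λ p q x → trans (p x) (q x)
              }
            ; ∙-cong = λ {v} {v′} {w} {w′} p q x →
                trans (cong (v ⟨$⟩_) (q x)) (p (w′ ⟨$⟩ x))
            }
          ; assoc = λ _ _ _ _ → refl
          }
        ; identity = (λ _ _ → refl) , (λ _ _ → refl)
        }
      ; inverse = (λ w → from-to (perm w)) , (λ w → to-from (perm w))
      ; ⁻¹-cong = λ {v} {w} → from-cong (perm v) (perm w)
      }
    }

  open Group C̃ using (_≈_; _∙_; _⁻¹)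

  private
    mirror-generated : ∀ {π} → Generated π →
      ∀ k x → Inverse.to π (k * N - x) ≡ k * N - Inverse.to π x
    mirror-generated (gen g) = HopProperties.mirror (hop g)
    mirror-generated unit k x = refl
    mirror-generated (comp {π} {ρ} p q) k x =
      trans (cong (Inverse.to π) (mirror-generated q k x)) (mirror-generated p k _)
    mirror-generated (inv {π} p) k x = begin
      from (k * N - x)               ≡⟨ cong (λ y → from (k * N - y)) (to-from π x) ⟨
      from (k * N - to (from x))     ≡⟨ cong from (mirror-generated p k (from x)) ⟨
      from (to (k * N - from x))     ≡⟨ from-to π _ ⟩
      k * N - from x                 ∎
      where
      open Inverse π using (to; from)
      open ≡-Reasoning
    mirror-generated (resp {π} {ρ} eq p) k x =
      trans (sym (eq _)) (trans (mirror-generated p k x) (cong (_-_ (k * N)) (eq x)))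

  module _ (w : Element) where

    -- w(x) + w(2a(n+1) - x) = 2a(n+1), with 2a(n+1) written as a * N.
    ⟨$⟩-mirror : ∀ a x → w ⟨$⟩ (a * N - x) ≡ a * N - w ⟨$⟩ x
    ⟨$⟩-mirror = mirror-generated (generated w)

    ⟨$⟩-neg : ∀ x → w ⟨$⟩ (- x) ≡ - (w ⟨$⟩ x)
    ⟨$⟩-neg x = trans (cong (w ⟨$⟩_) (e x N)) (trans (⟨$⟩-mirror 0ℤ x) (sym (e (w ⟨$⟩ x) N)))
      where
      e : ∀ x N → - x ≡ 0ℤ * N - x
      e = solve-∀

    ⟨$⟩-shift : ∀ x q → w ⟨$⟩ (x + q * N) ≡ w ⟨$⟩ x + q * N
    ⟨$⟩-shift x q = begin
      w ⟨$⟩ (x + q * N)       ≡⟨ cong (w ⟨$⟩_) (e x (q * N)) ⟩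
      w ⟨$⟩ (q * N - - x)     ≡⟨ ⟨$⟩-mirror q (- x) ⟩
      q * N - w ⟨$⟩ (- x)     ≡⟨ cong (_-_ (q * N)) (⟨$⟩-neg x) ⟩
      q * N - - (w ⟨$⟩ x)     ≡⟨ e (w ⟨$⟩ x) (q * N) ⟨
      w ⟨$⟩ x + q * N         ∎
      where
      open ≡-Reasoning
      e : ∀ x k → x + k ≡ k - - x
      e = solve-∀

    ⟨$⟩-injective : ∀ {x y} → w ⟨$⟩ x ≡ w ⟨$⟩ y → x ≡ y
    ⟨$⟩-injective {x} {y} eq =
      trans (sym (from-to (perm w) x)) (trans (cong (Inverse.from (perm w)) eq) (from-to (perm w) y))

    ⟨$⟩-fixes-walls : ∀ a → w ⟨$⟩ (a * + (n ℕ.+ 1)) ≡ a * + (n ℕ.+ 1)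
    ⟨$⟩-fixes-walls a = half (begin
      W + W                      ≡⟨ cong (λ y → w ⟨$⟩ y + W) (trans (e₀ a (+ n)) (cong (λ N → a * N - y₀) (sym N≡))) ⟩
      w ⟨$⟩ (a * N - y₀) + W     ≡⟨ cong (_+ W) (⟨$⟩-mirror a y₀) ⟩
      a * N - W + W              ≡⟨ e₁ (a * N) W ⟩
      a * N                      ≡⟨ cong (a *_) N≡ ⟩
      a * (+ 2 * + n + + 2)      ≡⟨ e₂ a (+ n) ⟩
      y₀ + y₀                    ∎)
      where
      open ≡-Reasoning
      y₀ = a * + (n ℕ.+ 1)
      W = w ⟨$⟩ y₀
      e₀ : ∀ a n → a * (n + + 1) ≡ a * (+ 2 * n + + 2) - a * (n + + 1)
      e₀ = solve-∀
      e₁ : ∀ x y → x - y + y ≡ x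
      e₁ = solve-∀
      e₂ : ∀ a n → a * (+ 2 * n + + 2) ≡ a * (n + + 1) + a * (n + + 1)
      e₂ = solve-∀
      e₃ : ∀ x → x + x ≡ + 2 * x
      e₃ = solve-∀
      half : ∀ {x y} → x + x ≡ y + y → x ≡ y
      half {x} {y} eq = ℤ.*-cancelˡ-≡ (+ 2) x y (trans (sym (e₃ x)) (trans eq (e₃ y)))

    ⟨$⟩-≅ : ∀ {x y} → x ≅ y → w ⟨$⟩ x ≅ w ⟨$⟩ y
    ⟨$⟩-≅ {x} {y} p with k , refl ← ≅⇒shift {x} {y} p =
      subst (_≅ w ⟨$⟩ y) (sym (⟨$⟩-shift y k)) (shift-≅ (w ⟨$⟩ y) k)

    ¬Wall-image : ∀ {i} → ¬ Wall i → ¬ Wall (w ⟨$⟩ i)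
    ¬Wall-image {i} ¬p (divides a eq) =
      ¬p (divides a (⟨$⟩-injective (trans eq (sym (⟨$⟩-fixes-walls a)))))

    ≇-image : ∀ {i j} → ¬ i ≅ j → ¬ w ⟨$⟩ i ≅ w ⟨$⟩ j
    ≇-image {i} {j} ¬p q with k , eq ← ≅⇒shift {w ⟨$⟩ i} {w ⟨$⟩ j} q =
      ¬p (subst (_≅ j) (sym (⟨$⟩-injective (trans eq (sym (⟨$⟩-shift j k))))) (shift-≅ j k))

  record IsTransposition (i j : ℤ) (t : Element) : Set where
    field
      at-i  : ∀ q → t ⟨$⟩ (i + q * N) ≡ j + q * N
      at-j  : ∀ q → t ⟨$⟩ (j + q * N) ≡ i + q * N
      at--i : ∀ q → t ⟨$⟩ (- i + q * N) ≡ - j + q * N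
      at--j : ∀ q → t ⟨$⟩ (- j + q * N) ≡ - i + q * N
      fixes : ∀ x → ¬ x ≅ i → ¬ x ≅ j → ¬ x ≅ - i → ¬ x ≅ - j → t ⟨$⟩ x ≡ x

  private
    Transposition : ℤ → ℤ → Set
    Transposition i j = Σ[ t ∈ Element ] IsTransposition i j t

    +0N : ∀ x → x + 0ℤ * N ≡ x
    +0N x = e x N
      where
      e : ∀ x N → x + 0ℤ * N ≡ x
      e = solve-∀

    swaps : ∀ {i j} ((t , _) : Transposition i j) → t ⟨$⟩ i ≡ j
    swaps {i} {j} (t , T) =
      trans (cong (t ⟨$⟩_) (sym (+0N i))) (trans (IsTransposition.at-i T 0ℤ) (+0N j))

    fixed : ∀ {i j} ((t , _) : Transposition i j) {x} →
            ¬ x ≅ i → ¬ x ≅ - i → ¬ x ≅ j → ¬ x ≅ - j → t ⟨$⟩ x ≡ x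
    fixed (t , T) {x} p q r u = IsTransposition.fixes T x p r q u

    swap : ∀ {i j} → Transposition i j → Transposition j i
    swap (t , T) = t , record
      { at-i = at-j ; at-j = at-i ; at--i = at--j ; at--j = at--i
      ; fixes = λ x p q r u → fixes x q p u r
      }
      where open IsTransposition T

    negate : ∀ {i j} → Transposition i j → Transposition (- i) (- j)
    negate {i} {j} (t , T) = t , record
      { at-i = at--i ; at-j = at--j
      ; at--i = λ q → trans (cong (λ y → t ⟨$⟩ (y + q * N)) (ℤ.neg-involutive i))
                     (trans (at-i q) (cong (_+ q * N) (sym (ℤ.neg-involutive j))))
      ; at--j = λ q → trans (cong (λ y → t ⟨$⟩ (y + q * N)) (ℤ.neg-involutive j))
                     (trans (at-j q) (cong (_+ q * N) (sym (ℤ.neg-involutive i))))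
      ; fixes = λ x p q r u → fixes x
          (λ v → r (subst (x ≅_) (sym (ℤ.neg-involutive i)) v))
          (λ v → u (subst (x ≅_) (sym (ℤ.neg-involutive j)) v)) p q
      }
      where open IsTransposition T

    shift : ∀ {i j} k → Transposition i j → Transposition (i + k * N) (j + k * N)
    shift {i} {j} k (t , T) = t , record
      { at-i  = λ q → trans (cong (t ⟨$⟩_) (e i k q N)) (trans (at-i (k + q)) (sym (e j k q N)))
      ; at-j  = λ q → trans (cong (t ⟨$⟩_) (e j k q N)) (trans (at-j (k + q)) (sym (e i k q N)))
      ; at--i = λ q → trans (cong (t ⟨$⟩_) (e′ i k q N)) (trans (at--i (q - k)) (sym (e′ j k q N)))
      ; at--j = λ q → trans (cong (t ⟨$⟩_) (e′ j k q N)) (trans (at--j (q - k)) (sym (e′ i k q N)))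
      ; fixes = λ x p q r u → fixes x
          (λ v → p (≅-trans {x} v (≅-sym {i + k * N} (shift-≅ i k))))
          (λ v → q (≅-trans {x} v (≅-sym {j + k * N} (shift-≅ j k))))
          (λ v → r (≅-trans {x} v (≅-neg {i} (≅-sym {i + k * N} (shift-≅ i k)))))
          (λ v → u (≅-trans {x} v (≅-neg {j} (≅-sym {j + k * N} (shift-≅ j k)))))
      }
      where
      open IsTransposition T
      e : ∀ i k q N → i + k * N + q * N ≡ i + (k + q) * N
      e = solve-∀
      e′ : ∀ i k q N → - (i + k * N) + q * N ≡ - i + (q - k) * N
      e′ = solve-∀

    conjugate : ∀ {i j} w → Transposition i j → Transposition (w ⟨$⟩ i) (w ⟨$⟩ j)
    conjugate {i} {j} w (t , T) = w ∙ t ∙ (w ⁻¹) , record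
      { at-i  = λ q → along i j q (at-i q)
      ; at-j  = λ q → along j i q (at-j q)
      ; at--i = λ q → subst₂ (λ a b → u ⟨$⟩ (a + q * N) ≡ b + q * N)
                        (⟨$⟩-neg w i) (⟨$⟩-neg w j) (along (- i) (- j) q (at--i q))
      ; at--j = λ q → subst₂ (λ a b → u ⟨$⟩ (a + q * N) ≡ b + q * N)
                        (⟨$⟩-neg w j) (⟨$⟩-neg w i) (along (- j) (- i) q (at--j q))
      ; fixes = λ x p q r v → trans
          (cong (w ⟨$⟩_) (fixes (w ⁻¹ ⟨$⟩ x) (p ∘ back x) (q ∘ back x)
            (λ m → r (subst (x ≅_) (⟨$⟩-neg w i) (back x m)))
            (λ m → v (subst (x ≅_) (⟨$⟩-neg w j) (back x m)))))
          (to-from (perm w) x)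
      }
      where
      open IsTransposition T
      u = w ∙ t ∙ (w ⁻¹)
      along : ∀ a b q → t ⟨$⟩ (a + q * N) ≡ b + q * N →
              u ⟨$⟩ (w ⟨$⟩ a + q * N) ≡ w ⟨$⟩ b + q * N
      along a b q eq = begin
        w ⟨$⟩ t ⟨$⟩ w ⁻¹ ⟨$⟩ (w ⟨$⟩ a + q * N) ≡⟨ cong (λ y → w ⟨$⟩ t ⟨$⟩ w ⁻¹ ⟨$⟩ y) (⟨$⟩-shift w a q) ⟨
        w ⟨$⟩ t ⟨$⟩ w ⁻¹ ⟨$⟩ w ⟨$⟩ (a + q * N) ≡⟨ cong (λ y → w ⟨$⟩ t ⟨$⟩ y) (from-to (perm w) _) ⟩
        w ⟨$⟩ t ⟨$⟩ (a + q * N)                ≡⟨ cong (w ⟨$⟩_) eq ⟩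
        w ⟨$⟩ (b + q * N)                      ≡⟨ ⟨$⟩-shift w b q ⟩
        w ⟨$⟩ b + q * N                        ∎
        where open ≡-Reasoning
      back : ∀ x {y} → w ⁻¹ ⟨$⟩ x ≅ y → x ≅ w ⟨$⟩ y
      back x {y} m = subst (_≅ w ⟨$⟩ y) (to-from (perm w) x) (⟨$⟩-≅ w {w ⁻¹ ⟨$⟩ x} m)

    simple-transposition : ∀ g → Transposition (base g) (base g + width g)
    simple-transposition g = element (simple g) (gen g) , record
      { at-i  = λ q → trans (up₁ (shift-≅ a q)) (e₁ a δ (q * N))
      ; at-j  = λ q → trans (down₁ (shift-≅ (a + δ) q)) (e₂ a δ (q * N))
      ; at--i = λ q → trans (down₂ (shift-≅ (- a) q)) (e₃ a δ (q * N))
      ; at--j = λ q → trans (up₂ (subst (- (a + δ) + q * N ≅_) (e₅ a δ) (shift-≅ (- (a + δ)) q)))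
                            (e₄ a δ (q * N))
      ; fixes = λ x p q r u → stay p (λ v → u (subst (x ≅_) (sym (e₅ a δ)) v)) q r
      }
      where
      open Hop (hop g)
      a = base g
      δ = width g
      e₁ : ∀ a δ K → a + K + δ ≡ a + δ + K
      e₁ = solve-∀
      e₂ : ∀ a δ K → a + δ + K - δ ≡ a + K
      e₂ = solve-∀
      e₃ : ∀ a δ K → - a + K - δ ≡ - (a + δ) + K
      e₃ = solve-∀
      e₄ : ∀ a δ K → - (a + δ) + K + δ ≡ - a + K
      e₄ = solve-∀
      e₅ : ∀ a δ → - (a + δ) ≡ - a - δ
      e₅ = solve-∀

    shifted : ∀ {a b x y} → x ≅ a → x - a ≡ y - b → Transposition a b → Transposition x y
    shifted {a} {b} {x} {y} p eq t with k , refl ← ≅⇒shift {x} {a} p =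
      subst (Transposition x) (trans (e a b (k * N)) (trans (cong (λ c → b + c) eq) (e′ b y))) (shift k t)
      where
      e : ∀ a b K → b + K ≡ b + (a + K - a)
      e = solve-∀
      e′ : ∀ b y → b + (y - b) ≡ y
      e′ = solve-∀

    M = + (n ℕ.+ 1)

    N≡2M : N ≡ + 2 * M
    N≡2M = trans N≡ (e (+ n))
      where
      e : ∀ n → + 2 * n + + 2 ≡ + 2 * (n + + 1)
      e = solve-∀

    ≅⇒Wall : ∀ {x} c → x ≅ c → Wall c → Wall x
    ≅⇒Wall {x} c p q = subst (M ∣_) (e x c) (∣m∣n⇒∣m+n (∣-trans (divides (+ 2) N≡2M) p) q)
      where
      e : ∀ x c → x - c + c ≡ x
      e = solve-∀

    M∤1 : ¬ Wall (+ 1)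
    M∤1 p = >⇒∤ (ℕ.<-≤-trans (s≤s (s≤s z≤n)) (ℕ.≤-trans 2≤n (ℕ.m≤m+n n 1))) (∣⇒∣ᵤ p)

    data Next (x : ℤ) : Set where
      one : Transposition x (x + + 1) → Next x
      two : Wall (x + + 1) → Transposition x (x + + 2) → Next x

    next : ∀ x → ¬ Wall x → Next x
    next x ¬W = go (x %ℕ period) (n%ℕd<d x period) (divides (x /ℕ period) (trans (cong (_- + r) (a≡a%ℕn+[a/ℕn]*n x period)) (e (+ r) ((x /ℕ period) * N))))
      where
      period = 2 ℕ.* n ℕ.+ 2
      instance
        period≢0 : ℕ.NonZero period
        period≢0 = ℕ.>-nonZero (ℕ.<-trans (s≤s z≤n) 2<N)
      r = x %ℕ period
      e : ∀ r q → r + q - r ≡ q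
      e = solve-∀
      diff : ∀ x a δ → x - a ≡ x + δ - (a + δ)
      diff = solve-∀
      from : ∀ g → x ≅ base g → Transposition x (x + width g)
      from g p = shifted {base g} p (diff x (base g) (width g)) (simple-transposition g)
      wall+1 : ∀ c → x ≅ c → Wall (c + + 1) → Wall (x + + 1)
      wall+1 c p = ≅⇒Wall (c + + 1) (by (f x c) p)
        where
        f : ∀ x c → x + + 1 - (c + + 1) ≡ x - c
        f = solve-∀
      high : ∀ r → n ℕ.+ 1 ℕ.< r → r ℕ.< period → x ≅ + r → Next x
      high r lo hi p with ℕ.m≤n⇒∃[o]m+o≡n hi
      ... | zero  , eq = two (wall+1 (- + 1) x≅-1 (divides 0ℤ refl)) (from s₀ x≅-1)
        where
        f : ∀ x r → x - - + 1 ≡ (x - r) + (+ 1 + r + + 0)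
        f = solve-∀
        x≅-1 : x ≅ - + 1
        x≅-1 = by₂ (f x (+ r)) p (subst (N ∣_) (cong +_ (sym eq)) ∣-refl)
      ... | suc m , eq = one (shifted { - (+ i + + 1)} { - + i} x≅ (f′ x (+ i)) (negate (swap (simple-transposition (s i (s≤s z≤n) i<n)))))
        where
        i = suc m
        f : ∀ x r i → x - - (i + + 1) ≡ (x - r) + (+ 1 + r + i)
        f = solve-∀
        x≅ : x ≅ - (+ i + + 1)
        x≅ = by₂ (f x (+ r) (+ i)) p (subst (N ∣_) (cong +_ (sym eq)) ∣-refl)
        f′ : ∀ x i → x - - (i + + 1) ≡ x + + 1 - - i
        f′ = solve-∀
        open import Data.Nat.Tactic.RingSolver renaming (solve-∀ to ℕ-solve-∀)
        g₁ : ∀ n i → (n ℕ.+ 2) ℕ.+ suc i ≡ suc ((n ℕ.+ 1) ℕ.+ suc i)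
        g₁ = ℕ-solve-∀
        g₂ : ∀ n → 2 ℕ.* n ℕ.+ 2 ≡ (n ℕ.+ 2) ℕ.+ n
        g₂ = ℕ-solve-∀
        i<n : i ℕ.< n
        i<n = ℕ.+-cancelˡ-< (n ℕ.+ 2) i n (begin-strict
          n ℕ.+ 2 ℕ.+ i         ≡⟨ g₁ n m ⟩
          suc (n ℕ.+ 1 ℕ.+ i)   <⟨ s≤s (ℕ.+-monoˡ-< i lo) ⟩
          suc r ℕ.+ i           ≡⟨ eq ⟩
          period                ≡⟨ g₂ n ⟩
          n ℕ.+ 2 ℕ.+ n         ∎)
          where open ℕ.≤-Reasoning
      go : ∀ r → r ℕ.< period → x ≅ + r → Next x
      go zero _ p = ⊥-elim (¬W (≅⇒Wall 0ℤ p (divides 0ℤ refl)))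
      go r@(suc _) hi p with ℕ.<-cmp r n
      ... | tri< r<n _ _ = one (from (s r (s≤s z≤n) r<n) p)
      ... | tri≈ _ refl _ = two (wall+1 (+ n) p ∣-refl) (from sₙ p)
      ... | tri> _ _ n<r with ℕ.m≤n⇒m<n∨m≡n n<r
      ...   | inj₁ lt = high r (subst (ℕ._< r) (ℕ.+-comm 1 n) lt) hi p
      ...   | inj₂ refl = ⊥-elim (¬W (≅⇒Wall (+ suc n) p (∣-reflexive (cong +_ (ℕ.+-comm n 1)))))

    record Link (x y : ℤ) : Set where
      constructor link
      field
        target : ¬ Wall y
        via    : Transposition x y

    ascend : ∀ d x → ¬ Wall x → ¬ Wall (x + + d) → Star Link x (x + + d)
    ascend zero x p q = subst (Star Link x) (sym (ℤ.+-identityʳ x)) ε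
    ascend (suc d) x p q with next x p
    ascend (suc d) x p q | one t with x+1? ← + (n ℕ.+ 1) ∣? x + + 1 | x+1?
    ... | no r = link r t ◅ subst (Star Link (x + + 1)) (ℤ.+-assoc x (+ 1) (+ d))
                     (ascend d (x + + 1) r (q ∘ subst Wall (ℤ.+-assoc x (+ 1) (+ d))))
    ... | yes r = ⊥-elim (¬Wall-x+1 r)
      where
      -- A wall would be fixed by the transposition, which moves it to x.
      ¬Wall-x+1 : ¬ Wall (x + + 1)
      ¬Wall-x+1 (divides a eq) = p (divides a (trans (sym (swaps (swap t)))
        (trans (cong (proj₁ t ⟨$⟩_) eq) (⟨$⟩-fixes-walls (proj₁ t) a))))
    ascend (suc zero) x p q | two W _ = ⊥-elim (q W)
    ascend (suc (suc d)) x p q | two W t =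
      link r t ◅ subst (Star Link (x + + 2)) (ℤ.+-assoc x (+ 2) (+ d))
        (ascend d (x + + 2) r (q ∘ subst Wall (ℤ.+-assoc x (+ 2) (+ d))))
      where
      e : ∀ x → (x + + 2) - (x + + 1) ≡ + 1
      e = solve-∀
      r : ¬ Wall (x + + 2)
      r V = M∤1 (subst Wall (e x) (∣m∣n⇒∣m-n V W))

    reverse : ∀ {x y} → ¬ Wall x → Star Link x y → Star Link y x
    reverse p ls = go p ε ls
      where
      go : ∀ {x y z} → ¬ Wall x → Star Link x z → Star Link x y → Star Link y z
      go p acc ε = acc
      go p acc (link q t ◅ ls) = go q (link p (swap t) ◅ acc) ls

    connected : ∀ x y → ¬ Wall x → ¬ Wall y → Star Link x y
    connected x y p q with y - x in eq
    ... | + d = subst (Star Link x) x+d≡y (ascend d x p (q ∘ subst Wall x+d≡y))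
      where
      e : ∀ x y → x + (y - x) ≡ y
      e = solve-∀
      x+d≡y : x + + d ≡ y
      x+d≡y = trans (cong (λ k → x + k) (sym eq)) (e x y)
    ... |  -[1+ d ] = reverse q (subst (Star Link y) y+d≡x (ascend (suc d) y q (p ∘ subst Wall y+d≡x)))
      where
      e : ∀ x y → y - (y - x) ≡ x
      e = solve-∀
      y+d≡x : y + + suc d ≡ x
      y+d≡x = trans (cong (λ k → y - k) (sym eq)) (e x y)

    moves : ∀ {x y} → Star Link x y → Σ[ w ∈ Element ] w ⟨$⟩ x ≡ y
    moves ε = element (↔-id ℤ) unit , refl
    moves (link _ t ◅ ls) with w , eq ← moves ls =
      w ∙ proj₁ t , trans (cong (w ⟨$⟩_) (swaps t)) eq

    reflect : ∀ x y → ¬ Wall x → x ≅ - y → Transposition x y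
    reflect x y p (divides k eq) = go (k %ℕ 2) (n%ℕd<d k 2) (a≡a%ℕn+[a/ℕn]*n k 2)
      where
      m = k /ℕ 2
      K = m * N
      ¬Wall-x-K : ¬ Wall (x - K)
      ¬Wall-x-K q = p (≅⇒Wall (x - K) (by (e x K) (N∣kN m)) q)
        where
        e : ∀ x K → x - (x - K) ≡ K
        e = solve-∀
      ¬Wall-n : ¬ Wall (+ n)
      ¬Wall-n q = M∤1 (∣m+n∣m⇒∣n {m = + n} ∣-refl q)
      cancel : ∀ x K → x - K + K ≡ x
      cancel = solve-∀
      go : ∀ r → r ℕ.< 2 → k ≡ + r + m * + 2 → Transposition x y
      go 0 _ eq′ with w , w1 ← moves (connected (+ 1) (x - K) M∤1 ¬Wall-x-K) =
        subst₂ Transposition (trans (cong (_+ K) w1) (cancel x K))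
          (trans (cong (_+ K) (trans (⟨$⟩-neg w (+ 1)) (cong -_ w1)))
            (trans (f₁ x K) (trans (cong (_- x) (trans (f₂ m N) (trans (cong (_* N) (sym eq′)) (sym eq)))) (f₃ x y))))
          (shift m (conjugate w (swap (simple-transposition s₀))))
        where
        f₁ : ∀ x K → - (x - K) + K ≡ (K + K) - x
        f₁ = solve-∀
        f₂ : ∀ m N → m * N + m * N ≡ (+ 0 + m * + 2) * N
        f₂ = solve-∀
        f₃ : ∀ x y → x - - y - x ≡ y
        f₃ = solve-∀
      go 1 _ eq′ with w , wn ← moves (connected (+ n) (x - K) ¬Wall-n ¬Wall-x-K) =
        subst₂ Transposition (trans (cong (_+ K) wn) (cancel x K))
          (trans (cong (_+ K) (trans (cong (w ⟨$⟩_) (trans (f₀ (+ n)) (cong (λ N → 1ℤ * N - + n) (sym N≡))))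
                                     (trans (⟨$⟩-mirror w 1ℤ (+ n)) (cong (_-_ (1ℤ * N)) wn))))
            (trans (f₁ x m N) (trans (cong (_- x) (trans (cong (_* N) (sym eq′)) (sym eq))) (f₃ x y))))
          (shift m (conjugate w (simple-transposition sₙ)))
        where
        f₀ : ∀ n → n + + 2 ≡ 1ℤ * (+ 2 * n + + 2) - n
        f₀ = solve-∀
        f₁ : ∀ x m N → 1ℤ * N - (x - m * N) + m * N ≡ (+ 1 + m * + 2) * N - x
        f₁ = solve-∀
        f₃ : ∀ x y → x - - y - x ≡ y
        f₃ = solve-∀
      go (suc (suc _)) (s≤s (s≤s ())) _

    ¬Wall-neg : ∀ {x} → ¬ Wall x → ¬ Wall (- x)
    ¬Wall-neg {x} p q = p (subst Wall (ℤ.neg-involutive x) (∣m⇒∣-m q))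

    -- A transposition of i and z can be turned into one of i and any z′ ≅ ± z
    -- by conjugating with reflections that fix i.
    retarget- : ∀ {i z z′} → ¬ Wall z → ¬ i ≅ z → ¬ i ≅ - z → z ≅ - z′ →
                Transposition i z → Transposition i z′
    retarget- {i} {z} {z′} Wz p q r t =
      subst₂ Transposition (fixed ρ p q p′ q′) (swaps ρ) (conjugate (proj₁ ρ) t)
      where
      ρ = reflect z z′ Wz r
      p′ : ¬ i ≅ z′
      p′ u = q (≅-trans {i} u (≅-sym { - z} (≅-neg⁻¹ {z} r)))
      q′ : ¬ i ≅ - z′
      q′ u = p (≅-trans {i} u (≅-sym {z} r))

    retarget : ∀ {i z z′} → ¬ Wall z → ¬ i ≅ z → ¬ i ≅ - z → z ≅ z′ →
               Transposition i z → Transposition i z′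
    retarget {i} {z} {z′} Wz p q r t =
      retarget- (¬Wall-neg Wz) q (p ∘ subst (i ≅_) (ℤ.neg-involutive z)) (≅-neg {z} r)
        (retarget- Wz p q (subst (z ≅_) (sym (ℤ.neg-involutive z)) (≅-refl {z})) t)

    extend : ∀ {i y z} → ¬ Wall i → ¬ Wall z → Transposition y z →
             (¬ i ≅ y → Transposition i y) → ¬ i ≅ z → Transposition i z
    extend {i} {y} {z} Wi Wz t ih p with i ≅? - z
    ... | yes q = reflect i z Wi q
    ... | no q with i ≅? y
    ...   | yes r = retarget (λ W → Wz (≅⇒Wall (z′ ) (≅-sym {z′} z′≅z) W))
              (λ u → p (≅-trans {i} u z′≅z))
              (λ u → q (≅-trans {i} u (≅-neg {z′} z′≅z))) z′≅z
              (shifted r (e i y z) t)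
      where
      z′ = i - y + z
      e : ∀ i y z → i - y ≡ i - y + z - z
      e = solve-∀
      z′≅z : z′ ≅ z
      z′≅z = by (sym (e i y z)) r
    ...   | no r with i ≅? - y
    ...     | yes u = retarget- (λ W → ¬Wall-neg Wz (≅⇒Wall z′ (≅-sym {z′} z′≅-z) W))
                (λ v → q (≅-trans {i} v z′≅-z))
                (λ v → p (≅-trans {i} v (≅-neg⁻¹ {z′} z′≅-z))) z′≅-z
                (shifted u (e i y z) (negate t))
      where
      z′ = i - - y + - z
      e : ∀ i y z → i - - y ≡ i - - y + - z - - z
      e = solve-∀
      z′≅-z : z′ ≅ - z
      z′≅-z = by (sym (e i y z)) u
    ...     | no u = subst₂ Transposition (fixed t r u p q) (swaps t) (conjugate (proj₁ t) (ih r))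

    along : ∀ {i y z} → ¬ Wall i → Star Link y z →
            (¬ i ≅ y → Transposition i y) → ¬ i ≅ z → Transposition i z
    along Wi ε ih = ih
    along Wi (link Wz t ◅ ls) ih = along Wi ls (extend Wi Wz t ih)

  -- Existence: consecutive elements of ℤ ∖ (n+1)ℤ are exchanged by a simple
  -- reflection, up to shift and sign.  Starting from y = i, move y to j through
  -- such steps, conjugating a transposition of i and y into one of i and the
  -- next element; the steps where y ≅ ± i or z ≅ - i are treated in extend.
  abstract
    tᶜ-exists : ∀ i j → ¬ Wall i → ¬ Wall j → ¬ i ≅ j → Σ[ t ∈ Element ] IsTransposition i j t
    tᶜ-exists i j p q = along p (connected i j p q) (λ i≇i → ⊥-elim (i≇i (≅-refl {i})))

  -- Determined up to ≈ by tᶜ-isTransposition, by isTransposition-unique.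
  tᶜ : ∀ i j → ¬ Wall i → ¬ Wall j → ¬ i ≅ j → Element
  tᶜ i j p q r = proj₁ (tᶜ-exists i j p q r)

  tᶜ-isTransposition : ∀ i j p q r → IsTransposition i j (tᶜ i j p q r)
  tᶜ-isTransposition i j p q r = proj₂ (tᶜ-exists i j p q r)

  isTransposition-unique : ∀ {i j t u} → IsTransposition i j t → IsTransposition i j u → t ≈ u
  isTransposition-unique {i} {j} {t} {u} T U x
    with x ≅? i | x ≅? j | x ≅? - i | x ≅? - j
  ... | yes p | _ | _ | _ with k , refl ← ≅⇒shift {x} {i} p =
        trans (IsTransposition.at-i T k) (sym (IsTransposition.at-i U k))
  ... | no _ | yes p | _ | _ with k , refl ← ≅⇒shift {x} {j} p =
        trans (IsTransposition.at-j T k) (sym (IsTransposition.at-j U k))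
  ... | no _ | no _ | yes p | _ with k , refl ← ≅⇒shift {x} { - i} p =
        trans (IsTransposition.at--i T k) (sym (IsTransposition.at--i U k))
  ... | no _ | no _ | no _ | yes p with k , refl ← ≅⇒shift {x} { - j} p =
        trans (IsTransposition.at--j T k) (sym (IsTransposition.at--j U k))
  ... | no p | no q | no r | no v =
        trans (IsTransposition.fixes T x p q r v) (sym (IsTransposition.fixes U x p q r v))

{-# OPTIONS --safe #-}
-- The conjugate of t^c_{w(i),w(j)} by w satisfies the conditions that define
-- t^c_{i,j}, because w commutes with negation and with translation by 2n+2.
module Submission where

open import Algebra.Bundles using (Group)
open import Data.Integer.Base using (ℤ; -_; _+_; _*_)
open import Data.Nat.Base using (ℕ; _≤_)
open import Relation.Binary.PropositionalEquality
  using (_≡_; sym; trans; cong; subst; subst₂; module ≡-Reasoning)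
open import Relation.Nullary.Negation using (¬_)
open import Defs

-- A transposition is determined by its values, so it suffices to see that `w ⁻¹ ∙ (u ∙ w)` has the
-- values of t^c_{i,j} when `u` is t^c_{w(i),w(j)}. As `w` respects negation and shifts by `N`, it
-- carries the classes of `i`, `j`, `- i`, `- j` to those of their images, where `u` acts as
-- required. Uniqueness then gives t^c_{i,j} = w⁻¹uw, and multiplying by `w` on the left gives the
-- claim.

module _ (n : ℕ) (2≤n : 2 ≤ n) where
  open TypeC n 2≤n
  open Group C̃ using (_∙_; _⁻¹; inverseˡ)

  conjugate-isTransposition : ∀ w {u i j} → IsTransposition (w ⟨$⟩ i) (w ⟨$⟩ j) u →
                              IsTransposition i j (w ⁻¹ ∙ (u ∙ w))
  conjugate-isTransposition w {u} {i} {j} U = record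
    { at-i  = λ q → pull i j q (at-i q)
    ; at-j  = λ q → pull j i q (at-j q)
    ; at--i = λ q → pull (- i) (- j) q (negated i j q (at--i q))
    ; at--j = λ q → pull (- j) (- i) q (negated j i q (at--j q))
    ; fixes = λ x x≇i x≇j x≇-i x≇-j → trans
        -- `w` is injective on residue classes, so `w ⟨$⟩ x` avoids the four classes that `u` moves.
        (cong (w ⁻¹ ⟨$⟩_) (fixes (w ⟨$⟩ x)
          (≇-image w {x} x≇i)
          (≇-image w {x} x≇j)
          (subst (λ y → ¬ w ⟨$⟩ x ≅ y) (⟨$⟩-neg w i) (≇-image w {x} x≇-i))
          (subst (λ y → ¬ w ⟨$⟩ x ≅ y) (⟨$⟩-neg w j) (≇-image w {x} x≇-j))))
        (inverseˡ w x)
    }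
    where
    open IsTransposition U
    open ≡-Reasoning

    pull : ∀ a b q → u ⟨$⟩ (w ⟨$⟩ a + q * N) ≡ w ⟨$⟩ b + q * N →
           w ⁻¹ ⟨$⟩ u ⟨$⟩ w ⟨$⟩ (a + q * N) ≡ b + q * N
    pull a b q eq = begin
      w ⁻¹ ⟨$⟩ u ⟨$⟩ w ⟨$⟩ (a + q * N)     ≡⟨ cong (λ y → w ⁻¹ ⟨$⟩ u ⟨$⟩ y) (⟨$⟩-shift w a q) ⟩
      w ⁻¹ ⟨$⟩ u ⟨$⟩ (w ⟨$⟩ a + q * N)     ≡⟨ cong (w ⁻¹ ⟨$⟩_) eq ⟩
      w ⁻¹ ⟨$⟩ (w ⟨$⟩ b + q * N)           ≡⟨ cong (w ⁻¹ ⟨$⟩_) (⟨$⟩-shift w b q) ⟨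
      w ⁻¹ ⟨$⟩ w ⟨$⟩ (b + q * N)           ≡⟨ inverseˡ w (b + q * N) ⟩
      b + q * N                            ∎

    -- The conditions on `u` speak of `- (w ⟨$⟩ a)`, while `pull` at `- a` needs `w ⟨$⟩ (- a)`;
    -- oddness of `w` identifies the two.
    negated : ∀ a b q → u ⟨$⟩ (- (w ⟨$⟩ a) + q * N) ≡ - (w ⟨$⟩ b) + q * N →
              u ⟨$⟩ (w ⟨$⟩ (- a) + q * N) ≡ w ⟨$⟩ (- b) + q * N
    negated a b q = subst₂ (λ y z → u ⟨$⟩ (y + q * N) ≡ z + q * N)
                           (sym (⟨$⟩-neg w a)) (sym (⟨$⟩-neg w b))

theorem3p15 : (n : ℕ) (2≤n : 2 ≤ n) →
    let open TypeC n 2≤n in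
    let open Group C̃ in
    (w : Carrier) (i j : ℤ) (i∉ : ¬ Wall i) (j∉ : ¬ Wall j) (i≇j : ¬ i ≅ j) →
    w ∙ tᶜ i j i∉ j∉ i≇j
    ≈ tᶜ (w ⟨$⟩ i) (w ⟨$⟩ j) (¬Wall-image w i∉) (¬Wall-image w j∉) (≇-image w {i} {j} i≇j) ∙ w
theorem3p15 n 2≤n w i j i∉ j∉ i≇j x = trans
  (cong (w ⟨$⟩_) (isTransposition-unique {i} {j} {t} {w ⁻¹ ∙ (t′ ∙ w)}
    (tᶜ-isTransposition i j i∉ j∉ i≇j)
    (conjugate-isTransposition n 2≤n w {t′} {i} {j} (tᶜ-isTransposition (w ⟨$⟩ i) (w ⟨$⟩ j) _ _ _)) x))
  -- Cancels the `w ∙ w ⁻¹` left in front of `t′ ∙ w`.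
  (inverseʳ w (t′ ⟨$⟩ w ⟨$⟩ x))
  where
  open TypeC n 2≤n
  open Group C̃ using (_∙_; _⁻¹; inverseʳ)
  t = tᶜ i j i∉ j∉ i≇j
  t′ = tᶜ (w ⟨$⟩ i) (w ⟨$⟩ j) (¬Wall-image w i∉) (¬Wall-image w j∉) (≇-image w {i} {j} i≇j)
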